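{- Linear optimization over the packing orbitope $O^{\le}_{p,q}$ can be solved in time $O(pq)$: there is an algorithm that, given integers $p\ge q\ge 1$ and an objective vector $d\in\mathbb{R}^{\mathcal{I}_{p,q}}$, computes in time $O(pq)$ an optimal solution of $\max\{\langle d,x\rangle : x\in O^{\le}_{p,q}\}$.
   Context: Notation: $[n]=\{1,\dots,n\}$, $\mathcal{I}_{p,q}=\{(i,j)\in[p]\times[q] : i\ge j\}$. The packing orbitope $O^{\le}_{p,q}$ is the convex hull of all 0/1-matrices of size $p\times q$ whose columns are in lexicographically decreasing (i.e., non-increasing, with row 1 the most significant position) order and that have at most one 1-entry per row. Since no such matrix has a 1 above its main diagonal, the entries $(i,j)$ with $i<j$ are dropped and $O^{\le}_{p,q}$ is regarded as a subset of $\mathbb{R}^{\mathcal{I}_{p,q}}$. Time is measured as the number of elementary operations, where arithmetic operations on and comparisons of real numbers have unit cost. -}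

module Defs where

open import Level using (Level; _⊔_; suc)
open import Algebra.Bundles using (CommutativeRing)
import Algebra.Definitions.RawMonoid as RawMonoidDefs
open import Data.Bool.Base as Bool using (Bool; true; false; if_then_else_; not; _∧_; _∨_)
open import Data.Fin.Base as Fin using (Fin; toℕ)
open import Data.Nat.Base as ℕ using (ℕ)
import Data.Nat.Properties as ℕ
open import Data.Product.Base using (Σ-syntax; ∃-syntax; _×_; _,_)
open import Data.Vec.Base using (Vec; tabulate)
import Data.Vec.Relation.Binary.Lex.Strict as Lex
open import Relation.Binary.Core using (Rel)
open import Relation.Binary.PropositionalEquality.Core using (_≡_)
open import Relation.Binary.Structures using (IsDecTotalOrder)
open import Relation.Nullary.Decidable.Core using (does; yes; no)
open import Relation.Nullary.Negation.Core using (¬_)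
open import Relation.Unary using (Pred)

-- Totally ordered fields with decidable comparison, standing in for ℝ with
-- comparison as a primitive.  No completeness is assumed.

record OrderedField (c ℓ₁ ℓ₂ : Level) : Set (suc (c ⊔ ℓ₁ ⊔ ℓ₂)) where
  infix  8 _⁻¹
  infix  4 _≤_
  field
    commutativeRing : CommutativeRing c ℓ₁

  open CommutativeRing commutativeRing public

  field
    _⁻¹             : Carrier → Carrier
    ⁻¹-cong         : ∀ {x y} → x ≈ y → x ⁻¹ ≈ y ⁻¹
    -- The value of 0# ⁻¹ is left arbitrary.
    ⁻¹-inverse      : ∀ {x} → ¬ x ≈ 0# → x * x ⁻¹ ≈ 1#
    0≉1             : ¬ 0# ≈ 1#
    _≤_             : Rel Carrier ℓ₂
    isDecTotalOrder : IsDecTotalOrder _≈_ _≤_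
    +-monoʳ-≤       : ∀ x {y z} → y ≤ z → x + y ≤ x + z
    *-nonNegative   : ∀ {x y} → 0# ≤ x → 0# ≤ y → 0# ≤ x * y

  open IsDecTotalOrder isDecTotalOrder public using (_≤?_)

  open RawMonoidDefs +-rawMonoid public using (sum)

------------------------------------------------------------------------
-- Packing orbitopes

-- Rows and columns are numbered from 0, which leaves i ≥ j unchanged.

record 𝓘 (p q : ℕ) : Set where
  constructor entry
  field
    row      : Fin p
    col      : Fin q
    .col≤row : toℕ col ℕ.≤ toℕ row

open 𝓘 public

_≤ₗₑₓ_ : ∀ {n} → Rel (Vec Bool n) _
_≤ₗₑₓ_ = Lex.Lex-≤ _≡_ Bool._<_

record IsPacking {p q : ℕ} (M : Fin p → Fin q → Bool) : Set where
  field
    rowAtMostOne  : ∀ i j k → M i j ≡ true → M i k ≡ true → j ≡ k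
    colsDecrease  : ∀ j k → j Fin.< k →
                    tabulate (λ i → M i k) ≤ₗₑₓ tabulate (λ i → M i j)

module Orbitope {c ℓ₁ ℓ₂} (F : OrderedField c ℓ₁ ℓ₂) where
  open OrderedField F renaming (Carrier to K)

  ConvexHull : ∀ {a s} {A : Set a} → Pred (A → K) s → Pred (A → K) (a ⊔ s ⊔ c ⊔ ℓ₁ ⊔ ℓ₂)
  ConvexHull S x =
    ∃[ n ] Σ[ v ∈ (Fin n → _ → K) ] Σ[ w ∈ (Fin n → K) ]
      (∀ k → S (v k)) ×
      (∀ k → 0# ≤ w k) ×
      sum w ≈ 1# ×
      (∀ a → x a ≈ sum (λ k → w k * v k a))

  PackingMatrix : ∀ {p q} → Pred (Fin p × Fin q → K) ℓ₁
  PackingMatrix {p} {q} X =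
    Σ[ M ∈ (Fin p → Fin q → Bool) ]
      IsPacking M × (∀ i j → X (i , j) ≈ (if M i j then 1# else 0#))

  -- The hull is taken in the space of all p × q matrices; the entries above
  -- the diagonal are dropped afterwards.
  PackingOrbitope : ∀ p q → Pred (𝓘 p q → K) (c ⊔ ℓ₁ ⊔ ℓ₂)
  PackingOrbitope p q x =
    Σ[ X ∈ (Fin p × Fin q → K) ]
      ConvexHull PackingMatrix X × (∀ e → x e ≈ X (row e , col e))

  sum𝓘 : ∀ {p q} → (𝓘 p q → K) → K
  sum𝓘 {p} {q} f = sum λ i → sum λ j → term i j
    where
    term : Fin p → Fin q → K
    term i j with toℕ j ℕ.≤? toℕ i
    ... | yes j≤i = f (entry i j j≤i)
    ... | no  _   = 0#

  ⟨_,_⟩ : ∀ {p q} → (𝓘 p q → K) → (𝓘 p q → K) → K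
  ⟨ d , x ⟩ = sum𝓘 λ e → d e * x e

  OptimalSolution : ∀ {p q} (d x : 𝓘 p q → K) → Set (c ⊔ ℓ₁ ⊔ ℓ₂)
  OptimalSolution {p} {q} d x =
    PackingOrbitope p q x ×
    (∀ y → PackingOrbitope p q y → ⟨ d , y ⟩ ≤ ⟨ d , x ⟩)

------------------------------------------------------------------------
-- A unit-cost real random access machine, as a while language

-- Memory consists of integer variables and of two-dimensional arrays of
-- integers and of field elements, each named by a natural number.  Field
-- elements cannot be converted to integers.  Integer arithmetic is limited to
-- addition and truncated subtraction, the usual restriction that keeps unit
-- cost for integers polynomially related to bit cost.

Name : Set
Name = ℕ

infixl 6 _⊕_ _⊖_
infixl 7 _⊗_ _⊘_

data IntExp : Set where
  lit     : ℕ → IntExp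
  var     : Name → IntExp
  intAt   : Name → IntExp → IntExp → IntExp
  _⊕_ _⊖_ : IntExp → IntExp → IntExp

data RealExp : Set where
  𝟎 𝟏             : RealExp
  realAt          : Name → IntExp → IntExp → RealExp
  _⊕_ _⊖_ _⊗_ _⊘_ : RealExp → RealExp → RealExp

data BoolExp : Set where
  intLeq   : IntExp → IntExp → BoolExp
  realLeq  : RealExp → RealExp → BoolExp
  neg      : BoolExp → BoolExp
  and or   : BoolExp → BoolExp → BoolExp

infixr 4 _⨾_

data Program : Set where
  skip          : Program
  setVar        : Name → IntExp → Program
  setInt        : Name → IntExp → IntExp → IntExp → Program
  setReal       : Name → IntExp → IntExp → RealExp → Program
  _⨾_           : Program → Program → Program
  ifThenElse    : BoolExp → Program → Program → Program
  while         : BoolExp → Program → Program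

intCost : IntExp → ℕ
intCost (lit _)       = 1
intCost (var _)       = 1
intCost (intAt _ i j) = 1 ℕ.+ intCost i ℕ.+ intCost j
intCost (a ⊕ b)       = 1 ℕ.+ intCost a ℕ.+ intCost b
intCost (a ⊖ b)       = 1 ℕ.+ intCost a ℕ.+ intCost b

realCost : RealExp → ℕ
realCost 𝟎              = 1
realCost 𝟏              = 1
realCost (realAt _ i j) = 1 ℕ.+ intCost i ℕ.+ intCost j
realCost (a ⊕ b)        = 1 ℕ.+ realCost a ℕ.+ realCost b
realCost (a ⊖ b)        = 1 ℕ.+ realCost a ℕ.+ realCost b
realCost (a ⊗ b)        = 1 ℕ.+ realCost a ℕ.+ realCost b
realCost (a ⊘ b)        = 1 ℕ.+ realCost a ℕ.+ realCost b

boolCost : BoolExp → ℕ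
boolCost (intLeq a b)  = 1 ℕ.+ intCost a ℕ.+ intCost b
boolCost (realLeq a b) = 1 ℕ.+ realCost a ℕ.+ realCost b
boolCost (neg b)       = 1 ℕ.+ boolCost b
boolCost (and a b)     = 1 ℕ.+ boolCost a ℕ.+ boolCost b
boolCost (or a b)      = 1 ℕ.+ boolCost a ℕ.+ boolCost b

module Machine {c ℓ₁ ℓ₂} (F : OrderedField c ℓ₁ ℓ₂) where
  open OrderedField F renaming (Carrier to K)

  record State : Set c where
    constructor state
    field
      vars  : Name → ℕ
      ints  : Name → ℕ → ℕ → ℕ
      reals : Name → ℕ → ℕ → K

  open State public

  update : ∀ {a} {A : Set a} → (Name → A) → Name → A → Name → A
  update f x v y = if does (x ℕ.≟ y) then v else f y

  updateAt : ∀ {a} {A : Set a} → (Name → ℕ → ℕ → A) → Name → ℕ → ℕ → A → Name → ℕ → ℕ → A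
  updateAt f x i j v = update f x (update (f x) i (update (f x i) j v))

  intVal : State → IntExp → ℕ
  intVal s (lit n)       = n
  intVal s (var x)       = vars s x
  intVal s (intAt x i j) = ints s x (intVal s i) (intVal s j)
  intVal s (a ⊕ b)       = intVal s a ℕ.+ intVal s b
  intVal s (a ⊖ b)       = intVal s a ℕ.∸ intVal s b

  realVal : State → RealExp → K
  realVal s 𝟎              = 0#
  realVal s 𝟏              = 1#
  realVal s (realAt x i j) = reals s x (intVal s i) (intVal s j)
  realVal s (a ⊕ b)        = realVal s a + realVal s b
  realVal s (a ⊖ b)        = realVal s a - realVal s b
  realVal s (a ⊗ b)        = realVal s a * realVal s b
  realVal s (a ⊘ b)        = realVal s a * realVal s b ⁻¹

  boolVal : State → BoolExp → Bool
  boolVal s (intLeq a b)  = does (intVal s a ℕ.≤? intVal s b)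
  boolVal s (realLeq a b) = does (realVal s a ≤? realVal s b)
  boolVal s (neg b)       = not (boolVal s b)
  boolVal s (and a b)     = boolVal s a ∧ boolVal s b
  boolVal s (or a b)      = boolVal s a ∨ boolVal s b

  setVarIn : State → Name → ℕ → State
  setVarIn s x v = record s { vars = update (vars s) x v }

  setIntIn : State → Name → ℕ → ℕ → ℕ → State
  setIntIn s x i j v = record s { ints = updateAt (ints s) x i j v }

  setRealIn : State → Name → ℕ → ℕ → K → State
  setRealIn s x i j v = record s { reals = updateAt (reals s) x i j v }

  infix 3 _,_⇓_within_

  -- P , s ⇓ s′ within t : started in s, P halts in s′ after exactly t
  -- elementary operations.
  data _,_⇓_within_ : Program → State → State → ℕ → Set c where
    skip    : ∀ {s} → skip , s ⇓ s within 1
    setVar  : ∀ {s x e} →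
              setVar x e , s ⇓ setVarIn s x (intVal s e) within 1 ℕ.+ intCost e
    setInt  : ∀ {s x i j e} →
              setInt x i j e , s ⇓ setIntIn s x (intVal s i) (intVal s j) (intVal s e)
                within 1 ℕ.+ intCost i ℕ.+ intCost j ℕ.+ intCost e
    setReal : ∀ {s x i j e} →
              setReal x i j e , s ⇓ setRealIn s x (intVal s i) (intVal s j) (realVal s e)
                within 1 ℕ.+ intCost i ℕ.+ intCost j ℕ.+ realCost e
    _⨾_     : ∀ {P Q s s′ s″ t u} →
              P , s ⇓ s′ within t → Q , s′ ⇓ s″ within u →
              P ⨾ Q , s ⇓ s″ within t ℕ.+ u
    ifTrue  : ∀ {b P Q s s′ t} → boolVal s b ≡ true → P , s ⇓ s′ within t →
              ifThenElse b P Q , s ⇓ s′ within 1 ℕ.+ boolCost b ℕ.+ t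
    ifFalse : ∀ {b P Q s s′ t} → boolVal s b ≡ false → Q , s ⇓ s′ within t →
              ifThenElse b P Q , s ⇓ s′ within 1 ℕ.+ boolCost b ℕ.+ t
    done    : ∀ {b P s} → boolVal s b ≡ false →
              while b P , s ⇓ s within 1 ℕ.+ boolCost b
    loop    : ∀ {b P s s′ s″ t u} → boolVal s b ≡ true →
              P , s ⇓ s′ within t → while b P , s′ ⇓ s″ within u →
              while b P , s ⇓ s″ within 1 ℕ.+ boolCost b ℕ.+ t ℕ.+ u

  -- The input is p and q in the integer variables 0 and 1 and d in the real
  -- array 0; all other memory is arbitrary.  The output is read from the real
  -- array 1.
  record HoldsInput (s : State) (p q : ℕ) (d : 𝓘 p q → K) : Set ℓ₁ where
    field
      holds-p : vars s 0 ≡ p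
      holds-q : vars s 1 ≡ q
      holds-d : ∀ e → reals s 0 (toℕ (row e)) (toℕ (col e)) ≈ d e

  output : ∀ {p q} → State → 𝓘 p q → K
  output s e = reals s 1 (toℕ (row e)) (toℕ (col e))

{-# OPTIONS --safe #-}
module Submission where

-- A matrix with at most one 1 per row has decreasing columns exactly if every 1 in
-- a column j + 1 is preceded by a 1 in column j, in a higher row: otherwise the first
-- 1 of some column would make it larger than its left neighbour.  So, once the first
-- k columns have been used, the next row may use any of the columns 0, …, k, or none,
-- and nothing else about the rows above matters.  The best completion of the last n
-- rows therefore satisfies a recursion over the pairs (n , k).  Each of its O(pq) steps
-- takes constant time because the best of the first k columns of a row is maintained
-- as k grows; following the recorded choices from (p , 0) gives an optimal vertex.
-- Linearity of the objective extends optimality from the vertices to the hull.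

open import Defs
import Algebra.Properties.CommutativeMonoid.Sum
import Algebra.Properties.Ring
import Algebra.Properties.Semiring.Sum
open import Data.Bool.Base as Bool using (Bool; true; false; if_then_else_; _∧_; f<t; not)
open import Data.Bool.Properties as Bool using (T-≡)
open import Data.Fin.Base as Fin using (Fin; zero; suc; toℕ; fromℕ<)
open import Data.Fin.Properties using (any?; toℕ<n; toℕ-injective; toℕ-fromℕ<)
open import Data.Nat.Base
open import Data.Nat.Properties
  using (_≤?_; ≤-refl; ≤-trans; ≤-total; ≤-antisym; ≤-<-connex; <-irrefl; <-trans; <⇒≱; <⇒≢; ≰⇒>;
         ≮⇒≥; ≤∧≢⇒<; n≮0; <ᵇ⇒<; <⇒<ᵇ; ≡ᵇ⇒≡; ≡⇒≡ᵇ; suc-injective; m≤n⇒m≤1+n; n≤1+n; m≤n⇒m<n∨m≡n;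
         m≤n⇒m∸n≡0; m+[n∸m]≡n; m≤m+n; m≤n+m∸n; m≤m⊔n; m≤n⊔m; +-mono-≤)
import Data.Nat.Properties as ℕ
open import Data.Product.Base
open import Data.Sum.Base using (inj₁; inj₂)
open import Data.Unit.Base using (tt)
open import Data.Vec.Base using (tabulate)
import Data.Vec.Relation.Binary.Lex.Core as Lex
open import Function.Base using (_∘_)
open import Function.Bundles using (Equivalence)
open import Relation.Binary.Bundles using (Poset)
open import Relation.Binary.PropositionalEquality
  using (_≡_; _≢_; refl; sym; trans; cong; cong₂; subst; subst₂)
import Relation.Binary.Reasoning.PartialOrder
import Relation.Binary.Reasoning.Setoid
import Relation.Binary.Structures
open import Relation.Nullary
open import Relation.Nullary.Decidable using (dec-true; dec-false)

-- Lexicographic order of 0/1 columns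

≡true-ext : ∀ {a b} → (a ≡ true → b ≡ true) → (b ≡ true → a ≡ true) → a ≡ b
≡true-ext {true}          f g = sym (f refl)
≡true-ext {false} {true}  f g = g refl
≡true-ext {false} {false} f g = refl

≡ᵇ-true⇒≡ : ∀ {m n} → (m ≡ᵇ n) ≡ true → m ≡ n
≡ᵇ-true⇒≡ {m} {n} = ≡ᵇ⇒≡ m n ∘ Equivalence.from T-≡

≡⇒≡ᵇ-true : ∀ {m n} → m ≡ n → (m ≡ᵇ n) ≡ true
≡⇒≡ᵇ-true {m} {n} = Equivalence.to T-≡ ∘ ≡⇒≡ᵇ m n

-- Unless both vectors are zero, the first position with a 1 in either of them has it in `v` only,
-- since a 1 of `u` there would require an earlier 1 of `v`. This makes `v` larger.
≤ₗₑₓ-intro : ∀ {n} (u v : Fin n → Bool) →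
             (∀ i → u i ≡ true → ∃[ h ] h Fin.< i × v h ≡ true) →
             tabulate u ≤ₗₑₓ tabulate v
≤ₗₑₓ-intro {zero}  u v earlier = Lex.base tt
≤ₗₑₓ-intro {suc n} u v earlier with u zero in u₀ | v zero in v₀
... | true  | _     with _ , () , _ ← earlier zero u₀
... | false | true  = Lex.this f<t refl
... | false | false = Lex.next refl (≤ₗₑₓ-intro (u ∘ suc) (v ∘ suc) earlier′)
  where
  earlier′ : ∀ i → u (suc i) ≡ true → ∃[ h ] h Fin.< i × v (suc h) ≡ true
  earlier′ i uᵢ with earlier (suc i) uᵢ
  ... | zero  , _       , v₀′ = contradiction (trans (sym v₀) v₀′) λ ()
  ... | suc h , s≤s h<i , vₕ  = h , h<i , vₕ

-- Either the vectors agree up to `i`, or they first differ at some `h ≤ i`, where the larger vector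
-- `v` has the 1.
≤ₗₑₓ-elim : ∀ {n} (u v : Fin n → Bool) → tabulate u ≤ₗₑₓ tabulate v →
            ∀ i → u i ≡ true → ∃[ h ] h Fin.≤ i × v h ≡ true
≤ₗₑₓ-elim {suc n} u v (Lex.this u₀<v₀ _) i _ = zero , z≤n , <⇒true u₀<v₀
  where
  <⇒true : ∀ {a b} → a Bool.< b → b ≡ true
  <⇒true f<t = refl
≤ₗₑₓ-elim {suc n} u v (Lex.next u₀≡v₀ _) zero u₀ = zero , z≤n , trans (sym u₀≡v₀) u₀
≤ₗₑₓ-elim {suc n} u v (Lex.next _ u≤v) (suc i) uᵢ
  with h , h≤i , vₕ ← ≤ₗₑₓ-elim (u ∘ suc) (v ∘ suc) u≤v i uᵢ = suc h , s≤s h≤i , vₕ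

-- Row codes and restricted growth

-- A row with at most one 1 is coded by 0 if it vanishes and by j + 1 if its 1
-- is in column j.
fromCodes : ∀ {p q} → (Fin p → ℕ) → Fin p → Fin q → Bool
fromCodes c i j = c i ≡ᵇ suc (toℕ j)

rowCode : ∀ {q} (f : Fin q → Bool) → (∀ j k → f j ≡ true → f k ≡ true → j ≡ k) →
          ∃[ c ] c ≤ q × (∀ j → f j ≡ (c ≡ᵇ suc (toℕ j)))
rowCode {q} f unique with any? (λ j → f j Bool.≟ true)
... | yes (j , fⱼ) = suc (toℕ j) , toℕ<n j , λ k →
  ≡true-ext (λ fₖ → ≡⇒≡ᵇ-true (cong toℕ (unique j k fⱼ fₖ)))
            (λ j≡k → subst (λ k → f k ≡ true) (toℕ-injective (≡ᵇ-true⇒≡ j≡k)) fⱼ)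
... | no  none     = 0 , z≤n , λ j → ≡true-ext (λ fⱼ → contradiction (j , fⱼ) none) λ ()

-- The first k columns count as opened before the first row; a column m ≥ k
-- must be opened by an earlier row before a column beyond it is used.
RestrictedGrowth : ∀ {p} → ℕ → (Fin p → ℕ) → Set
RestrictedGrowth k c = ∀ i m → k ≤ m → suc m < c i → ∃[ h ] h Fin.< i × c h ≡ suc m

fromCodes-isPacking : ∀ {p q} {c : Fin p → ℕ} → RestrictedGrowth 0 c →
                      IsPacking {p} {q} (fromCodes c)
fromCodes-isPacking {c = c} growth = record
  { rowAtMostOne = λ i j k cᵢ≡j cᵢ≡k → toℕ-injective (suc-injective
      (trans (sym (≡ᵇ-true⇒≡ {c i} cᵢ≡j)) (≡ᵇ-true⇒≡ {c i} cᵢ≡k)))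
  ; colsDecrease = λ j k j<k → ≤ₗₑₓ-intro _ _ λ i cᵢ≡k →
      let h , h<i , cₕ≡j = growth i (toℕ j) z≤n
                             (subst (suc (toℕ j) <_) (sym (≡ᵇ-true⇒≡ {c i} cᵢ≡k)) (s≤s j<k))
      in  h , h<i , ≡⇒≡ᵇ-true cₕ≡j
  }

isPacking⇒codes : ∀ {p q} {M : Fin p → Fin q → Bool} → IsPacking M →
                  ∃[ c ] (∀ i → c i ≤ q) × RestrictedGrowth 0 c ×
                         (∀ i j → M i j ≡ fromCodes c i j)
isPacking⇒codes {p} {q} {M} packing = c , c≤q , growth , M≡c
  where
  open IsPacking packing
  code = λ i → rowCode (M i) (rowAtMostOne i)
  c    = λ i → proj₁ (code i)
  c≤q  = λ i → proj₁ (proj₂ (code i))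
  M≡c  = λ i → proj₂ (proj₂ (code i))

  growth : RestrictedGrowth 0 c
  growth i m _ 1+m<cᵢ = open-before (c i) refl 1+m<cᵢ
    where
    -- The variable `b` in place of `c i` can be matched as a successor; the 1 of row `i` is then in
    -- column `b` of the clause below. Column `m` is compared with that column directly, whatever
    -- lies between them.
    open-before : ∀ b → c i ≡ b → suc m < b → ∃[ h ] h Fin.< i × c h ≡ suc m
    open-before (suc b) cᵢ≡1+b (s≤s m<b) = h , ≤∧≢⇒< h≤i h≢i , cₕ≡1+m
      where
      b<q = subst (_≤ q) cᵢ≡1+b (c≤q i)
      m<q = <-trans m<b b<q
      Mᵢ  = trans (M≡c i (fromℕ< b<q))
              (≡⇒≡ᵇ-true (trans cᵢ≡1+b (cong suc (sym (toℕ-fromℕ< b<q)))))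
      used = ≤ₗₑₓ-elim _ _
               (colsDecrease (fromℕ< m<q) (fromℕ< b<q)
                 (subst₂ _<_ (sym (toℕ-fromℕ< m<q)) (sym (toℕ-fromℕ< b<q)) m<b))
               i Mᵢ
      h   = proj₁ used
      h≤i = proj₁ (proj₂ used)
      cₕ≡1+m : c h ≡ suc m
      cₕ≡1+m = trans (≡ᵇ-true⇒≡ {c h} (trans (sym (M≡c h _)) (proj₂ (proj₂ used))))
                 (cong suc (toℕ-fromℕ< m<q))
      -- Row `i` has its only 1 in column `b`, which differs from `m`; so the weak inequality from
      -- the lexicographic order is strict.
      h≢i : toℕ h ≢ toℕ i
      h≢i h≡i = <⇒≢ m<b (suc-injective (trans (sym cₕ≡1+m)
                  (trans (cong c (toℕ-injective h≡i)) cᵢ≡1+b)))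

-- Inequalities and indicator sums in ordered fields

module OrderedFieldProperties {c ℓ₁ ℓ₂} (F : OrderedField c ℓ₁ ℓ₂) where
  open OrderedField F public
    renaming (Carrier to K; _+_ to _+ᴷ_; _*_ to _*ᴷ_; _≤_ to _≤ᴷ_; _≤?_ to _≤ᴷ?_;
              +-comm to +ᴷ-comm; +-cong to +ᴷ-cong; *-cong to *ᴷ-cong; *-comm to *ᴷ-comm; *-assoc to *ᴷ-assoc;
              refl to ≈-refl; sym to ≈-sym; trans to ≈-trans; reflexive to ≈-reflexive;
              _-_ to _-ᴷ_)
    using (0#; 1#; _≈_; setoid; sum; +-monoʳ-≤; *-nonNegative; isDecTotalOrder;
           +-identityˡ; +-identityʳ; -‿inverseʳ; -‿inverseˡ; zeroʳ; zeroˡ; *-identityʳ; *-identityˡ;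
           +-assoc; ring; semiring; +-commutativeMonoid; distribˡ; -_)
  open Relation.Binary.Structures.IsDecTotalOrder isDecTotalOrder public
    using (isPartialOrder)
    renaming (refl to ≤ᴷ-refl; trans to ≤ᴷ-trans; total to ≤ᴷ-total;
              ≤-respʳ-≈ to ≤ᴷ-respʳ-≈; ≤-respˡ-≈ to ≤ᴷ-respˡ-≈)
  open Algebra.Properties.Semiring.Sum semiring public using (*-distribˡ-sum; *-distribʳ-sum)
  open Algebra.Properties.CommutativeMonoid.Sum +-commutativeMonoid public
    using (sum-cong-≋; ∑-comm; sum-replicate-zero)
  open Algebra.Properties.Ring ring using (-1*x≈-x; -‿involutive)

  ≤ᴷ-poset : Poset c ℓ₁ ℓ₂
  ≤ᴷ-poset = record { isPartialOrder = isPartialOrder }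

  module ≈-Reasoning = Relation.Binary.Reasoning.Setoid setoid
  module ≤ᴷ-Reasoning = Relation.Binary.Reasoning.PartialOrder ≤ᴷ-poset

  +ᴷ-monoˡ-≤ : ∀ z {x y} → x ≤ᴷ y → x +ᴷ z ≤ᴷ y +ᴷ z
  +ᴷ-monoˡ-≤ z {x} {y} x≤y = begin
    x +ᴷ z ≈⟨ +ᴷ-comm x z ⟩
    z +ᴷ x ≤⟨ +-monoʳ-≤ z x≤y ⟩
    z +ᴷ y ≈⟨ +ᴷ-comm z y ⟩
    y +ᴷ z ∎
    where open ≤ᴷ-Reasoning

  +ᴷ-mono-≤ : ∀ {x y u v} → x ≤ᴷ y → u ≤ᴷ v → x +ᴷ u ≤ᴷ y +ᴷ v
  +ᴷ-mono-≤ {y = y} {u = u} x≤y u≤v = ≤ᴷ-trans (+ᴷ-monoˡ-≤ u x≤y) (+-monoʳ-≤ y u≤v)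

  *ᴷ-monoʳ-≤ : ∀ {w x y} → 0# ≤ᴷ w → x ≤ᴷ y → w *ᴷ x ≤ᴷ w *ᴷ y
  *ᴷ-monoʳ-≤ {w} {x} {y} 0≤w x≤y = begin
    w *ᴷ x                          ≈⟨ +-identityˡ _ ⟨
    0# +ᴷ w *ᴷ x                    ≤⟨ +ᴷ-monoˡ-≤ (w *ᴷ x) (*-nonNegative 0≤w 0≤y-x) ⟩
    w *ᴷ (y -ᴷ x) +ᴷ w *ᴷ x         ≈⟨ distribˡ w (y -ᴷ x) x ⟨
    w *ᴷ (y -ᴷ x +ᴷ x)              ≈⟨ *ᴷ-cong ≈-refl (+-assoc y (- x) x) ⟩
    w *ᴷ (y +ᴷ (- x +ᴷ x))          ≈⟨ *ᴷ-cong ≈-refl (+ᴷ-cong ≈-refl (-‿inverseˡ x)) ⟩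
    w *ᴷ (y +ᴷ 0#)                  ≈⟨ *ᴷ-cong ≈-refl (+-identityʳ y) ⟩
    w *ᴷ y                          ∎
    where
    open ≤ᴷ-Reasoning
    0≤y-x : 0# ≤ᴷ y -ᴷ x
    0≤y-x = ≤ᴷ-respˡ-≈ (-‿inverseʳ x) (+ᴷ-monoˡ-≤ (- x) x≤y)

  sum-mono-≤ : ∀ {n} {f g : Fin n → K} → (∀ i → f i ≤ᴷ g i) → sum f ≤ᴷ sum g
  sum-mono-≤ {zero}  f≤g = ≤ᴷ-refl
  sum-mono-≤ {suc n} f≤g = +ᴷ-mono-≤ (f≤g zero) (sum-mono-≤ (f≤g ∘ suc))

  average-≤ : ∀ {n} {w u : Fin n → K} {b} → (∀ i → 0# ≤ᴷ w i) → sum w ≈ 1# →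
              (∀ i → u i ≤ᴷ b) → sum (λ i → w i *ᴷ u i) ≤ᴷ b
  average-≤ {w = w} {u} {b} 0≤w ∑w≈1 u≤b = begin
    sum (λ i → w i *ᴷ u i) ≤⟨ sum-mono-≤ (λ i → *ᴷ-monoʳ-≤ (0≤w i) (u≤b i)) ⟩
    sum (λ i → w i *ᴷ b)   ≈⟨ *-distribʳ-sum b w ⟨
    sum w *ᴷ b             ≈⟨ *ᴷ-cong ∑w≈1 ≈-refl ⟩
    1# *ᴷ b                ≈⟨ *-identityˡ b ⟩
    b                      ∎
    where open ≤ᴷ-Reasoning

  0≤1 : 0# ≤ᴷ 1#
  0≤1 with ≤ᴷ-total 0# 1#
  ... | inj₁ 0≤1 = 0≤1
  -- If 1 ≤ 0, then -1 is nonnegative, and so is its square, which is 1.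
  ... | inj₂ 1≤0 = ≤ᴷ-respʳ-≈ [-1]²≈1 (*-nonNegative 0≤-1 0≤-1)
    where
    0≤-1 : 0# ≤ᴷ - 1#
    0≤-1 = ≤ᴷ-respʳ-≈ (+-identityˡ (- 1#)) (≤ᴷ-respˡ-≈ (-‿inverseʳ 1#) (+ᴷ-monoˡ-≤ (- 1#) 1≤0))
    [-1]²≈1 : - 1# *ᴷ - 1# ≈ 1#
    [-1]²≈1 = ≈-trans (-1*x≈-x (- 1#)) (-‿involutive 1#)

  indicator : Bool → K
  indicator b = if b then 1# else 0#

  sum-zero : ∀ {n} {f : Fin n → K} → (∀ i → f i ≈ 0#) → sum f ≈ 0#
  sum-zero {n} f≈0 = ≈-trans (sum-cong-≋ f≈0) (sum-replicate-zero n)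

  sum-indicator : ∀ {n} (f : ℕ → K) {m} → m < n →
                  sum {n} (λ i → f (toℕ i) *ᴷ indicator (m ≡ᵇ toℕ i)) ≈ f m
  sum-indicator {suc n} f {zero} _ = begin
    f 0 *ᴷ 1# +ᴷ sum {n} (λ i → f (suc (toℕ i)) *ᴷ 0#)
      ≈⟨ +ᴷ-cong (*-identityʳ _) (sum-zero {n} λ i → zeroʳ _) ⟩
    f 0 +ᴷ 0#
      ≈⟨ +-identityʳ _ ⟩
    f 0 ∎
    where open ≈-Reasoning
  sum-indicator {suc n} f {suc m} (s≤s m<n) = begin
    f 0 *ᴷ 0# +ᴷ sum {n} (λ i → f (suc (toℕ i)) *ᴷ indicator (m ≡ᵇ toℕ i))
      ≈⟨ +ᴷ-cong (zeroʳ _) (sum-indicator (f ∘ suc) m<n) ⟩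
    0# +ᴷ f (suc m)
      ≈⟨ +-identityˡ _ ⟩
    f (suc m) ∎
    where open ≈-Reasoning

  -- Any nonzero code leaves a single term of the sum. Code 0 leaves none, which is why its weight
  -- has to be 0.
  sum-code : ∀ {q} (w : ℕ → K) {c} → w 0 ≡ 0# → c ≤ q →
             sum {q} (λ j → w (suc (toℕ j)) *ᴷ indicator (c ≡ᵇ suc (toℕ j))) ≈ w c
  sum-code {q} w {zero}  w₀≡0 _   = ≈-trans (sum-zero {q} λ j → zeroʳ _) (≈-reflexive (sym w₀≡0))
  sum-code     w {suc c} _    c<q = sum-indicator (w ∘ suc) c<q

-- The recursion over rows and opened columns

-- W n c is the weight of code c for the row with n rows below it.
module DynamicProgram {c ℓ₁ ℓ₂} (F : OrderedField c ℓ₁ ℓ₂) (q : ℕ)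
                      (W : ℕ → ℕ → OrderedField.Carrier F) where
  open OrderedFieldProperties F

  best : ℕ → ℕ → ℕ
  best n zero    = 0
  best n (suc k) = if does (W n (best n k) ≤ᴷ? W n (suc k)) then suc k else best n k

  -- This is k ⊔ c, in the arithmetic of the machine.
  opened : ℕ → ℕ → ℕ
  opened k c = k + (c ∸ k)

  -- The codes 0, ..., k all leave `k` columns opened, so only the heaviest of them competes with
  -- opening column `k`, and that is possible only if `k < q`.
  choice : ℕ → ℕ → ℕ
  value  : ℕ → ℕ → K
  choice n k =
    if does (suc k ≤? q) ∧ does (W n (best n k) +ᴷ value n k ≤ᴷ? W n (suc k) +ᴷ value n (suc k))
    then suc k else best n k
  value zero    k = 0#
  value (suc n) k = W n (choice n k) +ᴷ value n (opened k (choice n k))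

  optimalCodes : ∀ n → ℕ → Fin n → ℕ
  optimalCodes (suc n) k zero    = choice n k
  optimalCodes (suc n) k (suc i) = optimalCodes n (opened k (choice n k)) i

  objective : ∀ {n} → (Fin n → ℕ) → K
  objective {n} codes = sum λ i → W (n ∸ suc (toℕ i)) (codes i)

  opened-≤ : ∀ {k c} → c ≤ k → opened k c ≡ k
  opened-≤ {k} c≤k = trans (cong (k +_) (m≤n⇒m∸n≡0 c≤k)) (ℕ.+-identityʳ k)

  opened-> : ∀ {k c} → k ≤ c → opened k c ≡ c
  opened-> = m+[n∸m]≡n

  k≤opened : ∀ k c → k ≤ opened k c
  k≤opened k c = m≤m+n k (c ∸ k)

  c≤opened : ∀ k c → c ≤ opened k c
  c≤opened k c = m≤n+m∸n c k

  opened≤ : ∀ {k c m} → k ≤ m → c ≤ m → opened k c ≤ m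
  opened≤ {k} {c} k≤m c≤m with ≤-total c k
  ... | inj₁ c≤k = subst (_≤ _) (sym (opened-≤ c≤k)) k≤m
  ... | inj₂ k≤c = subst (_≤ _) (sym (opened-> k≤c)) c≤m

  best≤ : ∀ n k → best n k ≤ k
  best≤ n zero    = z≤n
  best≤ n (suc k) with does (W n (best n k) ≤ᴷ? W n (suc k))
  ... | true  = ≤-refl
  ... | false = m≤n⇒m≤1+n (best≤ n k)

  ≰ᴷ⇒≥ : ∀ {x y} → ¬ x ≤ᴷ y → y ≤ᴷ x
  ≰ᴷ⇒≥ {x} {y} x≰y with ≤ᴷ-total x y
  ... | inj₁ x≤y = contradiction x≤y x≰y
  ... | inj₂ y≤x = y≤x

  best-maximal : ∀ n {c k} → c ≤ k → W n c ≤ᴷ W n (best n k)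
  best-maximal n {zero} {zero} z≤n = ≤ᴷ-refl
  best-maximal n {c} {suc k} c≤1+k
    with W n (best n k) ≤ᴷ? W n (suc k) | m≤n⇒m<n∨m≡n c≤1+k
  ... | yes _     | inj₂ refl      = ≤ᴷ-refl
  ... | yes old≤  | inj₁ (s≤s c≤k) = ≤ᴷ-trans (best-maximal n c≤k) old≤
  ... | no  old≰  | inj₂ refl      = ≰ᴷ⇒≥ old≰
  ... | no  _     | inj₁ (s≤s c≤k) = best-maximal n c≤k

  choice≤1+k : ∀ n k → choice n k ≤ suc k
  -- `does (suc k ≤? q)` computes to `k <ᵇ q`, so abstracting over the latter makes `choice` reduce.
  choice≤1+k n k with k <ᵇ q in k<ᵇq
    | W n (best n k) +ᴷ value n k ≤ᴷ? W n (suc k) +ᴷ value n (suc k)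
  ... | true  | yes _ = ≤-refl
  ... | true  | no  _ = m≤n⇒m≤1+n (best≤ n k)
  ... | false | _     = m≤n⇒m≤1+n (best≤ n k)

  choice≤q : ∀ n {k} → k ≤ q → choice n k ≤ q
  choice≤q n {k} k≤q with k <ᵇ q in k<ᵇq
    | W n (best n k) +ᴷ value n k ≤ᴷ? W n (suc k) +ᴷ value n (suc k)
  ... | true  | yes _ = <ᵇ⇒< k q (Equivalence.from T-≡ k<ᵇq)
  ... | true  | no  _ = ≤-trans (best≤ n k) k≤q
  ... | false | _     = ≤-trans (best≤ n k) k≤q

  stay≤value : ∀ n k → W n (best n k) +ᴷ value n k ≤ᴷ value (suc n) k
  stay≤value n k with k <ᵇ q in k<ᵇq
    | W n (best n k) +ᴷ value n k ≤ᴷ? W n (suc k) +ᴷ value n (suc k)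
  ... | true  | yes stay≤ rewrite opened-> (n≤1+n k)    = stay≤
  ... | true  | no  _     rewrite opened-≤ (best≤ n k)  = ≤ᴷ-refl
  ... | false | _         rewrite opened-≤ (best≤ n k)  = ≤ᴷ-refl

  open≤value : ∀ n {k} → k < q → W n (suc k) +ᴷ value n (suc k) ≤ᴷ value (suc n) k
  open≤value n {k} k<q with k <ᵇ q in k<ᵇq
    | W n (best n k) +ᴷ value n k ≤ᴷ? W n (suc k) +ᴷ value n (suc k)
  ... | true  | yes _     rewrite opened-> (n≤1+n k)   = ≤ᴷ-refl
  ... | true  | no  stay≰ rewrite opened-≤ (best≤ n k) = ≰ᴷ⇒≥ stay≰
  ... | false | _         = contradiction (trans (sym k<ᵇq) (Equivalence.to T-≡ (<⇒<ᵇ k<q))) λ ()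

  -- For `c ≤ k` the number of opened columns stays `k`, so `c` can be exchanged for `best n k`; the
  -- only other code is `suc k`, the opening move.
  step≤value : ∀ n {k c} → c ≤ suc k → c ≤ q → W n c +ᴷ value n (opened k c) ≤ᴷ value (suc n) k
  step≤value n {k} c≤1+k c≤q with m≤n⇒m<n∨m≡n c≤1+k
  ... | inj₁ (s≤s c≤k) rewrite opened-≤ c≤k =
    ≤ᴷ-trans (+ᴷ-monoˡ-≤ (value n k) (best-maximal n c≤k)) (stay≤value n k)
  ... | inj₂ refl rewrite opened-> (n≤1+n k) = open≤value n c≤q

  -- Removing the first row leaves codes of restricted growth over `opened k c₀` columns. Induction
  -- bounds their weight, and `step≤value` accounts for the first row.
  objective≤value : ∀ {n} k (codes : Fin n → ℕ) → (∀ i → codes i ≤ q) →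
                    RestrictedGrowth k codes → objective codes ≤ᴷ value n k
  objective≤value {zero}  k codes codes≤q growth = ≤ᴷ-refl
  objective≤value {suc n} k codes codes≤q growth = begin
    W n c₀ +ᴷ objective (codes ∘ suc)
      ≤⟨ +-monoʳ-≤ _ (objective≤value (opened k c₀) (codes ∘ suc) (codes≤q ∘ suc) growth′) ⟩
    W n c₀ +ᴷ value n (opened k c₀)
      ≤⟨ step≤value n c₀≤1+k (codes≤q zero) ⟩
    value (suc n) k ∎
    where
    open ≤ᴷ-Reasoning
    c₀ = codes zero
    -- A larger code would need column `k` opened by a row above the first one.
    c₀≤1+k : c₀ ≤ suc k
    c₀≤1+k = ≮⇒≥ λ 1+k<c₀ → n≮0 (proj₁ (proj₂ (growth zero k ≤-refl 1+k<c₀)))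
    growth′ : RestrictedGrowth (opened k c₀) (codes ∘ suc)
    growth′ i m k′≤m 1+m<c with growth (suc i) m (≤-trans (k≤opened k c₀) k′≤m) 1+m<c
    -- If the removed row opened column `m`, then `m < opened k c₀`, contrary to `k′≤m`.
    ... | zero  , _       , c₀≡1+m =
      contradiction (subst (_≤ m) c₀≡1+m (≤-trans (c≤opened k c₀) k′≤m)) (<-irrefl refl)
    ... | suc h , s≤s h<i , cₕ≡1+m = h , h<i , cₕ≡1+m

  optimalCodes≤q : ∀ n {k} → k ≤ q → ∀ i → optimalCodes n k i ≤ q
  optimalCodes≤q (suc n) k≤q zero    = choice≤q n k≤q
  optimalCodes≤q (suc n) k≤q (suc i) = optimalCodes≤q n (opened≤ k≤q (choice≤q n k≤q)) i

  optimalCodes-growth : ∀ n k → RestrictedGrowth k (optimalCodes n k)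
  optimalCodes-growth (suc n) k zero m k≤m 1+m<c =
    contradiction (≤-trans 1+m<c (choice≤1+k n k)) (<⇒≱ (s≤s (s≤s k≤m)))
  optimalCodes-growth (suc n) k (suc i) m k≤m 1+m<c with ≤-<-connex (opened k (choice n k)) m
  ... | inj₁ k′≤m with h , h<i , cₕ ← optimalCodes-growth n _ i m k′≤m 1+m<c =
    suc h , s≤s h<i , cₕ
  -- Column `m` is not among the first `k` but is opened after the first row. A row opens at most
  -- column `k`, so the first row has code `suc m`.
  ... | inj₂ m<k′ = zero , s≤s z≤n , ≤-antisym (≤-trans (choice≤1+k n k) (s≤s k≤m)) m<c₀
    where
    m<c₀ : m < choice n k
    m<c₀ = ≰⇒> λ c₀≤m → <⇒≱ m<k′ (opened≤ k≤m c₀≤m)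

  objective-optimalCodes : ∀ n k → objective (optimalCodes n k) ≡ value n k
  objective-optimalCodes zero    k = refl
  objective-optimalCodes (suc n) k = cong (W n (choice n k) +ᴷ_) (objective-optimalCodes n _)

  openedBefore : ℕ → ℕ → ℕ → ℕ
  openedBefore n       k zero    = k
  openedBefore zero    k (suc i) = k
  openedBefore (suc n) k (suc i) = openedBefore n (opened k (choice n k)) i

  -- `openedBefore` recurses from the first row, whereas the output loop appends one row at the end;
  -- this reconciles the two directions.
  openedBefore-suc : ∀ n k {i} → i < n →
                     openedBefore n k (suc i) ≡
                     opened (openedBefore n k i) (choice (n ∸ suc i) (openedBefore n k i))
  openedBefore-suc (suc n) k {zero}  _         = refl
  openedBefore-suc (suc n) k {suc i} (s≤s i<n) = openedBefore-suc n _ i<n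

  openedBefore≤q : ∀ n {k} i → k ≤ q → openedBefore n k i ≤ q
  openedBefore≤q n       zero    k≤q = k≤q
  openedBefore≤q zero    (suc i) k≤q = k≤q
  openedBefore≤q (suc n) (suc i) k≤q = openedBefore≤q n i (opened≤ k≤q (choice≤q n k≤q))

  optimalCodes-openedBefore : ∀ n k (i : Fin n) → optimalCodes n k i ≡
                              choice (n ∸ suc (toℕ i)) (openedBefore n k (toℕ i))
  optimalCodes-openedBefore (suc n) k zero    = refl
  optimalCodes-openedBefore (suc n) k (suc i) = optimalCodes-openedBefore n _ i

-- From packing matrices to the orbitope

module Optimality {c ℓ₁ ℓ₂} (F : OrderedField c ℓ₁ ℓ₂) where
  open OrderedFieldProperties F
  open Orbitope F

  -- Extending the summand by zero above the diagonal turns the triangular sum into a rectangular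
  -- one, where sums can be interchanged freely.
  sum𝓘-cong : ∀ {p q} (f : 𝓘 p q → K) (g : Fin p → Fin q → K) →
              (∀ e → f e ≈ g (row e) (col e)) → (∀ i j → ¬ toℕ j ≤ toℕ i → g i j ≈ 0#) →
              sum𝓘 f ≈ sum (λ i → sum (g i))
  -- The left-hand side, a local function of sum𝓘, has no name here.
  termwise : ∀ {p q} (f : 𝓘 p q → K) (g : Fin p → Fin q → K) →
             (∀ e → f e ≈ g (row e) (col e)) → (∀ i j → ¬ toℕ j ≤ toℕ i → g i j ≈ 0#) →
             ∀ i j → _ ≈ g i j
  sum𝓘-cong {p} {q} f g f≈g g≈0 =
    sum-cong-≋ {p} λ i → sum-cong-≋ {q} λ j → termwise f g f≈g g≈0 i j
  termwise f g f≈g g≈0 i j with toℕ j ≤? toℕ i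
  ... | yes j≤i = f≈g (entry i j j≤i)
  ... | no  j≰i = ≈-sym (g≈0 i j j≰i)

  module _ {p q} (W : ℕ → ℕ → K) (d : 𝓘 p q → K)
           (W-zero  : ∀ n → W n 0 ≡ 0#)
           (W-entry : ∀ e → W (p ∸ suc (toℕ (row e))) (suc (toℕ (col e))) ≈ d e)
           (W-above : ∀ (i : Fin p) (j : Fin q) → ¬ toℕ j ≤ toℕ i →
                      W (p ∸ suc (toℕ i)) (suc (toℕ j)) ≈ 0#)
           where
    open DynamicProgram F q W

    -- The objective on full matrices. As `W` vanishes above the diagonal, the dropped entries do
    -- not affect it.
    total : (Fin p × Fin q → K) → K
    total X = sum λ i → sum λ j → W (p ∸ suc (toℕ i)) (suc (toℕ j)) *ᴷ X (i , j)

    ⟨⟩≈total : ∀ {x} X → (∀ e → x e ≈ X (row e , col e)) → ⟨ d , x ⟩ ≈ total X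
    ⟨⟩≈total X x≈X = sum𝓘-cong _ _
      (λ e → *ᴷ-cong (≈-sym (W-entry e)) (x≈X e))
      (λ i j j≰i → ≈-trans (*ᴷ-cong (W-above i j j≰i) ≈-refl) (zeroˡ _))

    total-cong : ∀ {X Y} → (∀ i j → X (i , j) ≈ Y (i , j)) → total X ≈ total Y
    total-cong X≈Y = sum-cong-≋ {p} λ i → sum-cong-≋ {q} λ j → *ᴷ-cong ≈-refl (X≈Y i j)

    total-fromCodes : ∀ {codes : Fin p → ℕ} → (∀ i → codes i ≤ q) →
                      total (λ (i , j) → indicator (fromCodes codes i j)) ≈ objective codes
    total-fromCodes codes≤q = sum-cong-≋ {p} λ i →
      sum-code (W (p ∸ suc (toℕ i))) (W-zero _) (codes≤q i)

    total-linear : ∀ {n} (v : Fin n → Fin p × Fin q → K) (w : Fin n → K) →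
                   total (λ a → sum (λ k → w k *ᴷ v k a)) ≈ sum (λ k → w k *ᴷ total (v k))
    total-linear {n} v w = begin
      (sum λ i → sum λ j → m i j *ᴷ sum λ k → w k *ᴷ v k (i , j))
        ≈⟨ (sum-cong-≋ {p} λ i → sum-cong-≋ {q} λ j → ≈-trans
             (*-distribˡ-sum {n} (m i j) _) (sum-cong-≋ {n} λ k → *-left-comm (m i j) (w k) _)) ⟩
      (sum λ i → sum λ j → sum λ k → w k *ᴷ (m i j *ᴷ v k (i , j)))
        ≈⟨ (sum-cong-≋ {p} λ i → ∑-comm {q} {n} _) ⟩
      (sum λ i → sum λ k → sum λ j → w k *ᴷ (m i j *ᴷ v k (i , j)))
        ≈⟨ (sum-cong-≋ {p} λ i → sum-cong-≋ {n} λ k → *-distribˡ-sum {q} (w k) _) ⟨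
      (sum λ i → sum λ k → w k *ᴷ sum λ j → m i j *ᴷ v k (i , j))
        ≈⟨ ∑-comm {p} {n} _ ⟩
      (sum λ k → sum λ i → w k *ᴷ sum λ j → m i j *ᴷ v k (i , j))
        ≈⟨ (sum-cong-≋ {n} λ k → *-distribˡ-sum {p} (w k) _) ⟨
      (sum λ k → w k *ᴷ total (v k)) ∎
      where
      open ≈-Reasoning
      m : Fin p → Fin q → K
      m i j = W (p ∸ suc (toℕ i)) (suc (toℕ j))
      *-left-comm : ∀ x y z → x *ᴷ (y *ᴷ z) ≈ y *ᴷ (x *ᴷ z)
      *-left-comm x y z = ≈-trans (≈-sym (*ᴷ-assoc x y z))
                     (≈-trans (*ᴷ-cong (*ᴷ-comm x y) ≈-refl) (*ᴷ-assoc y x z))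

    packingMatrix-bound : ∀ {X} → PackingMatrix X → total X ≤ᴷ value p 0
    packingMatrix-bound {X} (M , packing , X≈M)
      with codes , codes≤q , growth , M≡codes ← isPacking⇒codes packing = begin
      total X
        ≈⟨ total-cong (λ i j → ≈-trans (X≈M i j) (≈-reflexive (cong indicator (M≡codes i j)))) ⟩
      total (λ (i , j) → indicator (fromCodes codes i j))
        ≈⟨ total-fromCodes codes≤q ⟩
      objective codes
        ≤⟨ objective≤value 0 codes codes≤q growth ⟩
      value p 0 ∎
      where open ≤ᴷ-Reasoning

    packingOrbitope-bound : ∀ y → PackingOrbitope p q y → ⟨ d , y ⟩ ≤ᴷ value p 0
    packingOrbitope-bound y (X , (n , v , w , v∈ , 0≤w , ∑w≈1 , X≈) , y≈X) = begin
      ⟨ d , y ⟩                              ≈⟨ ⟨⟩≈total X y≈X ⟩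
      total X                                ≈⟨ total-cong (λ i j → X≈ (i , j)) ⟩
      total (λ a → sum (λ k → w k *ᴷ v k a)) ≈⟨ total-linear v w ⟩
      sum (λ k → w k *ᴷ total (v k))         ≤⟨ average-≤ 0≤w ∑w≈1 (λ k → packingMatrix-bound (v∈ k)) ⟩
      value p 0                              ∎
      where open ≤ᴷ-Reasoning

    optimalCodes-optimal : ∀ {x} → (∀ e → x e ≡ indicator (fromCodes (optimalCodes p 0) (row e) (col e))) →
                           OptimalSolution d x
    optimalCodes-optimal {x} x≡ =
      -- A vertex is a convex combination of one point, with weight 1.
      (X , (1 , (λ _ → X) , (λ _ → 1#) ,
            (λ _ → fromCodes (optimalCodes p 0) ,
                   fromCodes-isPacking (optimalCodes-growth p 0) , λ _ _ → ≈-refl) ,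
            (λ _ → 0≤1) , +-identityʳ 1# ,
            λ a → ≈-sym (≈-trans (+-identityʳ _) (*-identityˡ _))) ,
       λ e → ≈-reflexive (x≡ e)) ,
      λ y y∈ → ≤ᴷ-respʳ-≈ (≈-sym value≈) (packingOrbitope-bound y y∈)
      where
      X : Fin p × Fin q → K
      X (i , j) = indicator (fromCodes (optimalCodes p 0) i j)
      value≈ : ⟨ d , x ⟩ ≈ value p 0
      value≈ = ≈-trans (⟨⟩≈total X (λ e → ≈-reflexive (x≡ e)))
        (≈-trans (total-fromCodes (optimalCodes≤q p z≤n))
                 (≈-reflexive (objective-optimalCodes p 0)))

-- Counted loops and a timed program logic

for : Name → IntExp → Program → Program
for x e B = setVar x (lit 0) ⨾ while (neg (intLeq e (var x))) (B ⨾ setVar x (lit 1 ⊕ var x))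

selectInt : BoolExp → Name → IntExp → IntExp → IntExp → IntExp → Program
selectInt b x i j e₁ e₂ = ifThenElse b (setInt x i j e₁) (setInt x i j e₂)

selectReal : BoolExp → Name → IntExp → IntExp → RealExp → RealExp → Program
selectReal b x i j e₁ e₂ = ifThenElse b (setReal x i j e₁) (setReal x i j e₂)

-- Junk for programs with loops.
worstCost : Program → ℕ
worstCost skip               = 1
worstCost (setVar x e)       = 1 + intCost e
worstCost (setInt x i j e)   = 1 + intCost i + intCost j + intCost e
worstCost (setReal x i j e)  = 1 + intCost i + intCost j + realCost e
worstCost (P ⨾ Q)            = worstCost P + worstCost Q
worstCost (ifThenElse b P Q) = 1 + boolCost b + (worstCost P ⊔ worstCost Q)
worstCost (while b P)        = 0

guardCost : IntExp → ℕ
guardCost e = 1 + (1 + (1 + intCost e + 1))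

-- The 2 pays for setting the counter to 0, each 4 for an increment, and the last `guardCost e` for
-- the failing test that ends the loop.
forCost : IntExp → ℕ → ℕ → ℕ
forCost e N T = 2 + (N * (guardCost e + (T + 4)) + guardCost e)

module TimedExecution {c ℓ₁ ℓ₂} (F : OrderedField c ℓ₁ ℓ₂) where
  open Machine F public
  open OrderedFieldProperties F using (K)

  -- Total correctness in the style of Hoare logic, with a time bound; the rules below compose such
  -- judgements along the syntax.
  Runs : Program → State → ℕ → (State → Set c) → Set c
  Runs P s T R = ∃[ s′ ] ∃[ t ] (P , s ⇓ s′ within t) × t ≤ T × R s′

  runs-mono : ∀ {P s T R S} → (∀ {s} → R s → S s) → Runs P s T R → Runs P s T S
  runs-mono R⇒S (s′ , t , P⇓ , t≤T , r) = s′ , t , P⇓ , t≤T , R⇒S r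

  runs-setVar : ∀ {x e s} (R : State → Set c) → R (setVarIn s x (intVal s e)) →
                Runs (setVar x e) s (worstCost (setVar x e)) R
  runs-setVar R r = _ , _ , setVar , ≤-refl , r

  runs-setInt : ∀ {x i j e s} (R : State → Set c) → R (setIntIn s x (intVal s i) (intVal s j) (intVal s e)) →
                Runs (setInt x i j e) s (worstCost (setInt x i j e)) R
  runs-setInt R r = _ , _ , setInt , ≤-refl , r

  runs-setReal : ∀ {x i j e s} (R : State → Set c) → R (setRealIn s x (intVal s i) (intVal s j) (realVal s e)) →
                 Runs (setReal x i j e) s (worstCost (setReal x i j e)) R
  runs-setReal R r = _ , _ , setReal , ≤-refl , r

  infixr 4 _runs-⨾_
  _runs-⨾_ : ∀ {P Q s T U R S} → Runs P s T R → (∀ {s′} → R s′ → Runs Q s′ U S) →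
             Runs (P ⨾ Q) s (T + U) S
  (s′ , t , P⇓ , t≤T , r) runs-⨾ Q-runs with s″ , u , Q⇓ , u≤U , q ← Q-runs r =
    s″ , t + u , (P⇓ ⨾ Q⇓) , +-mono-≤ t≤T u≤U , q

  runs-if : ∀ {b P Q s T U R} → (boolVal s b ≡ true → Runs P s T R) →
            (boolVal s b ≡ false → Runs Q s U R) →
            Runs (ifThenElse b P Q) s (1 + boolCost b + (T ⊔ U)) R
  runs-if {b} {s = s} {T} {U} P-runs Q-runs with boolVal s b in eq
  ... | true  with s′ , t , P⇓ , t≤T , r ← P-runs refl =
    s′ , _ , ifTrue eq P⇓ , ℕ.+-monoʳ-≤ (1 + boolCost b) (≤-trans t≤T (m≤m⊔n T U)) , r
  ... | false with s′ , t , Q⇓ , t≤U , r ← Q-runs refl =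
    s′ , _ , ifFalse eq Q⇓ , ℕ.+-monoʳ-≤ (1 + boolCost b) (≤-trans t≤U (m≤n⊔m T U)) , r

  -- Both branches write the same cell, so the statement acts as one assignment of a conditional
  -- value. The equations replace guard and operands by their mathematical counterparts.
  runs-selectInt : ∀ {b x i j e₁ e₂ s β v₁ v₂} (R : State → Set c) →
                   boolVal s b ≡ β → intVal s e₁ ≡ v₁ → intVal s e₂ ≡ v₂ →
                   (∀ v → v ≡ (if β then v₁ else v₂) → R (setIntIn s x (intVal s i) (intVal s j) v)) →
                   Runs (selectInt b x i j e₁ e₂) s (worstCost (selectInt b x i j e₁ e₂)) R
  runs-selectInt {b} {s = s} R refl refl refl r =
    runs-if {b} (λ b≡true  → runs-setInt R (r _ (sym (cong (if_then _ else _) b≡true))))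
                (λ b≡false → runs-setInt R (r _ (sym (cong (if_then _ else _) b≡false))))

  runs-selectReal : ∀ {b x i j e₁ e₂ s β v₁ v₂} (R : State → Set c) →
                    boolVal s b ≡ β → realVal s e₁ ≡ v₁ → realVal s e₂ ≡ v₂ →
                    (∀ v → v ≡ (if β then v₁ else v₂) → R (setRealIn s x (intVal s i) (intVal s j) v)) →
                    Runs (selectReal b x i j e₁ e₂) s (worstCost (selectReal b x i j e₁ e₂)) R
  runs-selectReal {b} {s = s} R refl refl refl r =
    runs-if {b} (λ b≡true  → runs-setReal R (r _ (sym (cong (if_then _ else _) b≡true))))
                (λ b≡false → runs-setReal R (r _ (sym (cong (if_then _ else _) b≡false))))

  module _ {x e B T} (Inv : ℕ → State → Set c) {N}
           (counter : ∀ {n s} → Inv n s → vars s x ≡ n)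
           (bound   : ∀ {n s} → Inv n s → intVal s e ≡ N)
           (step    : ∀ {n s} → n < N → Inv n s →
                      Runs B s T (λ s′ → Inv (suc n) (setVarIn s′ x (suc (vars s′ x))))) where

    private
      guard≡ : ∀ {n s} → Inv n s → boolVal s (neg (intLeq e (var x))) ≡ not (N ≤ᵇ n)
      guard≡ inv = cong₂ (λ N n → not (N ≤ᵇ n)) (bound inv) (counter inv)

      n<N : ∀ {n r} → n + suc r ≡ N → n < N
      n<N {n} n+1+r≡N = subst (n <_) n+1+r≡N (ℕ.m<m+n n (s≤s z≤n))

      runs-while : ∀ r {n s} → n + r ≡ N → Inv n s →
                   Runs (while (neg (intLeq e (var x))) (B ⨾ setVar x (lit 1 ⊕ var x))) s
                        (r * (guardCost e + (T + 4)) + guardCost e) (Inv N)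
      runs-while zero {n} n≡N inv rewrite trans (sym (ℕ.+-identityʳ n)) n≡N =
        _ , _ , done (trans (guard≡ inv) (cong not N≤ᵇN)) , ≤-refl , inv
        where
        N≤ᵇN : (N ≤ᵇ N) ≡ true
        N≤ᵇN = Equivalence.to T-≡ (ℕ.≤⇒≤ᵇ (≤-refl {N}))
      runs-while (suc r) {n} {s} n+1+r≡N inv
        with _ , t , B⇓ , t≤T , inv′ ← step (n<N n+1+r≡N) inv
        with s₂ , u , W⇓ , u≤U , r′ ← runs-while r (trans (sym (ℕ.+-suc n r)) n+1+r≡N) inv′ =
        s₂ , _ , loop (trans (guard≡ inv) (cong not N≰ᵇn)) (B⇓ ⨾ setVar) W⇓ ,
        ≤-trans (+-mono-≤ (ℕ.+-monoʳ-≤ (guardCost e) (ℕ.+-monoˡ-≤ 4 t≤T)) u≤U)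
                (ℕ.≤-reflexive (sym (ℕ.+-assoc (guardCost e + (T + 4)) _ _))) ,
        r′
        where
        N≰ᵇn : (N ≤ᵇ n) ≡ false
        N≰ᵇn with N ≤ᵇ n in eq
        ... | false = refl
        ... | true  = contradiction (ℕ.≤ᵇ⇒≤ N n (Equivalence.from T-≡ eq)) (<⇒≱ (n<N n+1+r≡N))

    -- The guard evaluates `e` afresh in every pass, so the invariant has to fix the bound as well
    -- as the counter; the induction is on the number of passes left.
    runs-for : ∀ {s} → Inv 0 (setVarIn s x 0) → Runs (for x e B) s (forCost e N T) (Inv N)
    runs-for inv = runs-setVar (Inv 0) inv runs-⨾ runs-while N refl

  module _ {a} {A : Set a} where
    store : (ℕ → ℕ → A) → ℕ → ℕ → A → ℕ → ℕ → A
    store t i j v = update t i (update (t i) j v)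

    store-hit : ∀ t i j v → store t i j v i j ≡ v
    store-hit t i j v rewrite ≡⇒≡ᵇ-true {i} refl | ≡⇒≡ᵇ-true {j} refl = refl

    -- If the value written is the one that `S` prescribes, agreement with `S` survives whether or
    -- not the cell in question is overwritten.
    store-agree : ∀ (S t : ℕ → ℕ → A) {i j v} → v ≡ S i j →
                  ∀ {i′ j′} → t i′ j′ ≡ S i′ j′ → store t i j v i′ j′ ≡ S i′ j′
    store-agree S t {i} {j} v≡ {i′} {j′} t≡ with i ≡ᵇ i′ in i≡i′
    ... | false = t≡
    ... | true with refl ← ≡ᵇ-true⇒≡ {i} {i′} i≡i′ with j ≡ᵇ j′ in j≡j′
    ...   | false = t≡
    ...   | true  = trans v≡ (cong (S i) (≡ᵇ-true⇒≡ j≡j′))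

    store-extend : ∀ (S t : ℕ → ℕ → A) {i k v} → v ≡ S i k → (∀ j → j < k → t i j ≡ S i j) →
                   ∀ j → j < suc k → store t i k v i j ≡ S i j
    store-extend S t {i} {k} {v} v≡ t≡ j (s≤s j≤k) with m≤n⇒m<n∨m≡n j≤k
    ... | inj₁ j<k  = store-agree S t v≡ (t≡ j j<k)
    ... | inj₂ refl = trans (store-hit t i j v) v≡

-- The program and its cost

-- Variables 0 and 1 hold p and q, 2 and 3 are loop counters, and 4 is the number
-- of columns opened by the output so far.  Integer arrays 0 and 1 hold best and
-- choice; real arrays 0 to 3 hold d, the output, value and W.  Variable 2 is n
-- while the tables are filled and the row i in the output loop; since
-- i ↦ p ∸ suc i is an involution, rowAt converts either into the other.
module Algorithm where

  𝕡 𝕢 𝕟 𝕛 𝕜 : IntExp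
  𝕡 = var 0
  𝕢 = var 1
  𝕟 = var 2
  𝕛 = var 3
  𝕜 = var 4

  1+ : IntExp → IntExp
  1+ = lit 1 ⊕_

  rowAt : IntExp
  rowAt = 𝕡 ⊖ 1+ 𝕟

  bestAt choiceAt : IntExp → IntExp → IntExp
  bestAt   = intAt 0
  choiceAt = intAt 1

  dAt valueAt weightAt : IntExp → IntExp → RealExp
  dAt      = realAt 0
  valueAt  = realAt 2
  weightAt = realAt 3

  storeValue₀ storeWeight₀ storeBest₀ storeWeight storeBest storeChoice storeValue : Program
  storeValue₀  = setReal 2 (lit 0) 𝕛 𝟎
  storeWeight₀ = setReal 3 𝕟 (lit 0) 𝟎
  storeBest₀   = setInt 0 𝕟 (lit 0) (lit 0)
  storeWeight  = selectReal (intLeq 𝕛 rowAt) 3 𝕟 (1+ 𝕛) (dAt rowAt 𝕛) 𝟎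
  storeBest    = selectInt (realLeq (weightAt 𝕟 (bestAt 𝕟 𝕛)) (weightAt 𝕟 (1+ 𝕛)))
                   0 𝕟 (1+ 𝕛) (1+ 𝕛) (bestAt 𝕟 𝕛)
  -- For k = q the second comparison reads junk, which the conjunction discards.
  storeChoice  = selectInt
                   (and (intLeq (1+ 𝕛) 𝕢)
                        (realLeq (weightAt 𝕟 (bestAt 𝕟 𝕛) ⊕ valueAt 𝕟 𝕛)
                                 (weightAt 𝕟 (1+ 𝕛) ⊕ valueAt 𝕟 (1+ 𝕛))))
                   1 𝕟 𝕛 (1+ 𝕛) (bestAt 𝕟 𝕛)
  storeValue   = setReal 2 (1+ 𝕟) 𝕛
                   (weightAt 𝕟 (choiceAt 𝕟 𝕛) ⊕ valueAt 𝕟 (𝕛 ⊕ (choiceAt 𝕟 𝕛 ⊖ 𝕛)))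

  initialise fillRow fill : Program
  initialise = for 3 (1+ 𝕢) storeValue₀
  fillRow    = storeWeight₀ ⨾ storeBest₀ ⨾
               for 3 𝕢 (storeWeight ⨾ storeBest) ⨾
               for 3 (1+ 𝕢) (storeChoice ⨾ storeValue)
  fill       = for 2 𝕡 fillRow

  code : IntExp
  code = choiceAt rowAt 𝕜

  storeEntry openColumns traceRow trace : Program
  -- Integers can only be compared by ≤, so equality of the code with `1+ 𝕛` takes two tests.
  storeEntry  = selectReal (and (intLeq code (1+ 𝕛)) (intLeq (1+ 𝕛) code)) 1 𝕟 𝕛 𝟏 𝟎
  openColumns = setVar 4 (𝕜 ⊕ (code ⊖ 𝕜))
  traceRow    = for 3 𝕢 storeEntry ⨾ openColumns
  trace       = setVar 4 (lit 0) ⨾ for 2 𝕡 traceRow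

  optimise : Program
  optimise = initialise ⨾ fill ⨾ trace

  initialiseCost fillRowCost traceRowCost : ℕ → ℕ
  initialiseCost q = forCost (1+ 𝕢) (suc q) (worstCost storeValue₀)
  fillRowCost q    = worstCost storeWeight₀ + (worstCost storeBest₀ +
                     (forCost 𝕢 q (worstCost (storeWeight ⨾ storeBest)) +
                      forCost (1+ 𝕢) (suc q) (worstCost (storeChoice ⨾ storeValue))))
  traceRowCost q   = forCost 𝕢 q (worstCost storeEntry) + worstCost openColumns

  optimiseCost : ℕ → ℕ → ℕ
  optimiseCost p q = initialiseCost q +
                     (forCost 𝕡 p (fillRowCost q) + (2 + forCost 𝕡 p (traceRowCost q)))

-- The O(pq) bound

module CostBound where
  open Algorithm

  infix 4 _≼_
  -- This is f = O(m) with an explicit constant, uniform in all indices.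
  record _≼_ {I : Set} (f m : I → ℕ) : Set where
    constructor _,_
    field
      factor : ℕ
      bound  : ∀ i → f i ≤ m i * factor

  open _≼_ public

  +-≼ : ∀ {I : Set} {f g m : I → ℕ} → f ≼ m → g ≼ m → (λ i → f i + g i) ≼ m
  +-≼ {m = m} (a , f≤) (b , g≤) = a + b , λ i →
    ≤-trans (+-mono-≤ (f≤ i) (g≤ i)) (ℕ.≤-reflexive (sym (ℕ.*-distribˡ-+ (m i) a b)))

  -- A bound of the form `suc ∘ m` is at least 1 and so absorbs constants. Hence dimensions appear
  -- as successors from here on.
  const-≼ : ∀ {I : Set} {m : I → ℕ} x → (λ _ → x) ≼ (suc ∘ m)
  const-≼ {m = m} x = x , λ i → m≤m+n x (m i * x)

  *-≼ : ∀ {I J : Set} {f : J → ℕ} {m : I → ℕ} {n : J → ℕ} → f ≼ n →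
        (λ ((i , j) : I × J) → m i * f j) ≼ (λ (i , j) → m i * n j)
  *-≼ {m = m} {n} (a , f≤) = a , λ (i , j) →
    ≤-trans (ℕ.*-monoʳ-≤ (m i) (f≤ j)) (ℕ.≤-reflexive (sym (ℕ.*-assoc (m i) (n j) a)))

  self-≼ : ∀ {I : Set} {m : I → ℕ} x → (λ i → m i * x) ≼ m
  self-≼ x = x , λ _ → ≤-refl

  forCost-≼ : ∀ e T → (λ N → forCost e (suc N) T) ≼ suc
  forCost-≼ e T = +-≼ (const-≼ 2) (+-≼ (self-≼ (guardCost e + (T + 4))) (const-≼ (guardCost e)))

  forCost-suc-≼ : ∀ e T → (λ N → forCost e (2 + N) T) ≼ suc
  -- The product `(2 + N) * body` unfolds to `body + suc N * body`.
  forCost-suc-≼ e T = +-≼ (const-≼ 2) (+-≼ (+-≼ (const-≼ body) (self-≼ body)) (const-≼ (guardCost e)))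
    where body = guardCost e + (T + 4)

  tables-≼ : ∀ x y e T e′ T′ →
             (λ q → x + (y + (forCost e (suc q) T + forCost e′ (2 + q) T′))) ≼ suc
  tables-≼ x y e T e′ T′ =
    +-≼ (const-≼ x) (+-≼ (const-≼ y) (+-≼ (forCost-≼ e T) (forCost-suc-≼ e′ T′)))

  area : ℕ × ℕ → ℕ
  area (p , q) = suc p * suc q

  const-≼-area : ∀ x → (λ _ → x) ≼ area
  const-≼-area x = const-≼ {m = λ (p , q) → q + p * suc q} x

  rows-≼ : ∀ e {T : ℕ → ℕ} → (T ∘ suc) ≼ suc → (λ (p , q) → forCost e (suc p) (T (suc q))) ≼ area
  rows-≼ e {T} T≼ = +-≼ (const-≼-area 2) (+-≼
    (*-≼ {f = λ q → guardCost e + (T (suc q) + 4)} {m = suc} {n = suc} (+-≼ (const-≼ (guardCost e)) (+-≼ T≼ (const-≼ 4))))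
    (const-≼-area (guardCost e)))

  row-≼ : ∀ {T : ℕ → ℕ} → (T ∘ suc) ≼ suc → (λ (p , q) → T (suc q)) ≼ area
  row-≼ (a , T≤) = a , λ (p , q) → ≤-trans (T≤ q) (ℕ.*-monoˡ-≤ a (ℕ.m≤n*m (suc q) (suc p)))

  phases-≼ : ∀ e x {I R T : ℕ → ℕ} → (I ∘ suc) ≼ suc → (R ∘ suc) ≼ suc → (T ∘ suc) ≼ suc →
             (λ (p , q) → I (suc q) + (forCost e (suc p) (R (suc q)) +
                                       (x + forCost e (suc p) (T (suc q))))) ≼ area
  phases-≼ e x {I} {R} {T} I≼ R≼ T≼ =
    +-≼ (row-≼ {I} I≼) (+-≼ (rows-≼ e {R} R≼) (+-≼ (const-≼-area x) (rows-≼ e {T} T≼)))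

  -- Keeps the numeral factor from being unfolded into a unary number.
  abstract
    optimiseCost-≼ : (λ (p , q) → optimiseCost (suc p) (suc q)) ≼ area
    optimiseCost-≼ = phases-≼ 𝕡 2 {initialiseCost} {fillRowCost} {traceRowCost}
      (forCost-suc-≼ (1+ 𝕢) (worstCost storeValue₀))
      (tables-≼ (worstCost storeWeight₀) (worstCost storeBest₀)
                𝕢 (worstCost (storeWeight ⨾ storeBest)) (1+ 𝕢) (worstCost (storeChoice ⨾ storeValue)))
      (+-≼ (forCost-≼ 𝕢 (worstCost storeEntry)) (const-≼ (worstCost openColumns)))

-- Loop invariants and correctness of the program

≤ᵇ-antisym : ∀ m n → (m ≤ᵇ n) ∧ (n ≤ᵇ m) ≡ (m ≡ᵇ n)
≤ᵇ-antisym zero    zero    = refl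
≤ᵇ-antisym zero    (suc n) = refl
≤ᵇ-antisym (suc m) zero    = refl
≤ᵇ-antisym (suc m) (suc n) =
  trans (cong₂ _∧_ (<ᵇ-suc m n) (<ᵇ-suc n m)) (≤ᵇ-antisym m n)
  where
  <ᵇ-suc : ∀ m n → (m <ᵇ suc n) ≡ (m ≤ᵇ n)
  <ᵇ-suc zero    n = refl
  <ᵇ-suc (suc m) n = refl

-- Serves the guard of `storeChoice`: its second conjunct has to be correct only where the first one
-- holds, that is, for `k < q`.
∧-congˡ-true : ∀ {a b b′} → (a ≡ true → b ≡ b′) → a ∧ b ≡ a ∧ b′
∧-congˡ-true {true}  b≡b′ = b≡b′ refl
∧-congˡ-true {false} _    = refl

module Correctness {c ℓ₁ ℓ₂} (F : OrderedField c ℓ₁ ℓ₂) (p q : ℕ)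
                   (D : ℕ → ℕ → OrderedField.Carrier F) where
  open Algorithm
  open TimedExecution F
  open OrderedFieldProperties F

  -- The row with `n` rows below it is `p ∸ suc n`. Above the diagonal the input array may hold
  -- anything, so these weights are masked by 0.
  W : ℕ → ℕ → K
  W n zero    = 0#
  W n (suc j) = if does (j ≤? p ∸ suc n) then D (p ∸ suc n) j else 0#

  open DynamicProgram F q W

  -- D is the whole of real array 0, of which only the entries of 𝓘 p q matter.
  Base : State → Set c
  Base s = vars s 0 ≡ p × vars s 1 ≡ q × (∀ i j → reals s 0 i j ≡ D i j)

  Initialised : ℕ → State → Set c
  Initialised k s = vars s 3 ≡ k × Base s × (∀ j → j < k → reals s 2 0 j ≡ value 0 j)

  -- All rows of choices are kept for the output phase; of the values only row `n` is recorded,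
  -- since the recursion looks back a single row.
  Filled : ℕ → State → Set c
  Filled n s = vars s 2 ≡ n × Base s ×
               (∀ m k → m < n → k < suc q → ints s 1 m k ≡ choice m k) ×
               (∀ k → k < suc q → reals s 2 n k ≡ value n k)

  RowWeights : ℕ → ℕ → ℕ → State → Set c
  RowWeights n a b s = Filled n s ×
                       (∀ c → c < a → reals s 3 n c ≡ W n c) ×
                       (∀ k → k < b → ints s 0 n k ≡ best n k)

  RowValues : ℕ → ℕ → ℕ → State → Set c
  RowValues n a b s = RowWeights n (suc q) (suc q) s ×
                      (∀ k → k < a → ints s 1 n k ≡ choice n k) ×
                      (∀ k → k < b → reals s 2 (suc n) k ≡ value (suc n) k)

  -- The counter is kept apart from table conditions that do not mention variable 3 and so survive
  -- its increment.
  At : ℕ → (State → Set c) → State → Set c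
  At j R s = vars s 3 ≡ j × R s

  runs-storeWeight : ∀ {n j s} → At j (RowWeights n (suc j) (suc j)) s →
                     Runs storeWeight s (worstCost storeWeight) (At j (RowWeights n (2 + j) (suc j)))
  runs-storeWeight {n} {j} {s}
    (refl , filled@(refl , (p≡ , _ , D≡) , _) , weights , bests) =
    runs-selectReal (At j (RowWeights n (2 + j) (suc j)))
      (cong (λ r → does (j ≤? r)) row≡)
      (trans (D≡ _ _) (cong (λ r → D r j) row≡)) refl
      λ v v≡ → refl , filled , store-extend W (reals s 3) v≡ weights , bests
    where
    row≡ : vars s 0 ∸ suc n ≡ p ∸ suc n
    row≡ = cong (_∸ suc n) p≡

  runs-storeBest : ∀ {n j s} → At j (RowWeights n (2 + j) (suc j)) s →
                   Runs storeBest s (worstCost storeBest) (At j (RowWeights n (2 + j) (2 + j)))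
  runs-storeBest {n} {j} {s} (refl , filled@(refl , _) , weights , bests) =
    runs-selectInt (At j (RowWeights n (2 + j) (2 + j)))
      (cong₂ (λ x y → does (x ≤ᴷ? y))
        (trans (cong (reals s 3 n) (bests j ≤-refl)) (weights _ (s≤s (m≤n⇒m≤1+n (best≤ n j)))))
        (weights (suc j) ≤-refl))
      refl (bests j ≤-refl)
      λ v v≡ → refl , filled , weights , store-extend best (ints s 0) v≡ bests

  runs-storeChoice : ∀ {n k s} → k < suc q → At k (RowValues n k k) s →
                     Runs storeChoice s (worstCost storeChoice) (At k (RowValues n (suc k) k))
  runs-storeChoice {n} {k} {s} k<1+q@(s≤s k≤q)
    (refl , ((refl , base@(_ , q≡ , _) , choices , values) , weights , bests) , newChoices , newValues) =
    runs-selectInt (At k (RowValues n (suc k) k)) test≡ refl (bests k k<1+q)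
      λ v v≡ → refl , ((refl , base ,
                        (λ m l m<n l<1+q → store-agree choice (ints s 1) v≡ (choices m l m<n l<1+q)) ,
                        values) , weights , bests) ,
               store-extend choice (ints s 1) v≡ newChoices , newValues
    where
    stay open′ : K
    stay  = W n (best n k) +ᴷ value n k
    open′ = W n (suc k) +ᴷ value n (suc k)
    test≡ : _ ≡ does (suc k ≤? q) ∧ does (stay ≤ᴷ? open′)
    test≡ = trans (cong (λ q → does (suc k ≤? q) ∧ _) q≡) (∧-congˡ-true λ k<ᵇq →
      let k<q = <ᵇ⇒< k q (Equivalence.from T-≡ k<ᵇq) in
      cong₂ (λ x y → does (x ≤ᴷ? y))
        (cong₂ _+ᴷ_
          (trans (cong (reals s 3 n) (bests k k<1+q)) (weights _ (s≤s (≤-trans (best≤ n k) k≤q))))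
          (values k k<1+q))
        (cong₂ _+ᴷ_ (weights (suc k) (s≤s k<q)) (values (suc k) (s≤s k<q))))

  runs-storeValue : ∀ {n k s} → k < suc q → At k (RowValues n (suc k) k) s →
                    Runs storeValue s (worstCost storeValue) (At k (RowValues n (suc k) (suc k)))
  runs-storeValue {n} {k} {s} (s≤s k≤q)
    (refl , ((refl , base , choices , values) , weights , bests) , newChoices , newValues) =
    runs-setReal (At k (RowValues n (suc k) (suc k)))
      (refl , ((refl , base , choices ,
                λ l l<1+q → store-agree value (reals s 2) {suc n} {k} v≡ (values l l<1+q)) , weights , bests) ,
       newChoices , store-extend value (reals s 2) v≡ newValues)
    where
    choice≡ = newChoices k ≤-refl
    v≡ : _ ≡ value (suc n) k
    v≡ = cong₂ _+ᴷ_
      (trans (cong (reals s 3 n) choice≡) (weights _ (s≤s (choice≤q n k≤q))))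
      (trans (cong (λ c → reals s 2 n (k + (c ∸ k))) choice≡)
             (values _ (s≤s (opened≤ k≤q (choice≤q n k≤q)))))

  runs-weightLoop : ∀ {n s} → RowWeights n 1 1 s →
                    Runs (for 3 𝕢 (storeWeight ⨾ storeBest)) s
                         (forCost 𝕢 q (worstCost (storeWeight ⨾ storeBest)))
                         (RowWeights n (suc q) (suc q))
  runs-weightLoop {n} row = runs-mono {S = RowWeights n (suc q) (suc q)} proj₂
    (runs-for Inv proj₁ (λ (_ , (_ , (_ , q≡ , _) , _) , _) → q≡)
      (λ {j} _ inv → runs-storeWeight inv runs-⨾ λ inv′ →
        runs-mono {S = λ s → Inv (suc j) (setVarIn s 3 (suc (vars s 3)))} (λ (j≡ , row′) → cong suc j≡ , row′)
          (runs-storeBest inv′))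
      (refl , row))
    where
    Inv : ℕ → State → Set c
    Inv j = At j (RowWeights n (suc j) (suc j))

  runs-valueLoop : ∀ {n s} → RowWeights n (suc q) (suc q) s →
                   Runs (for 3 (1+ 𝕢) (storeChoice ⨾ storeValue)) s
                        (forCost (1+ 𝕢) (suc q) (worstCost (storeChoice ⨾ storeValue)))
                        (RowValues n (suc q) (suc q))
  runs-valueLoop {n} row = runs-mono {S = RowValues n (suc q) (suc q)} proj₂
    (runs-for Inv proj₁ (λ (_ , ((_ , (_ , q≡ , _) , _) , _) , _) → cong suc q≡)
      (λ {k} k<1+q inv → runs-storeChoice k<1+q inv runs-⨾ λ inv′ →
        runs-mono {S = λ s → Inv (suc k) (setVarIn s 3 (suc (vars s 3)))} (λ (k≡ , row′) → cong suc k≡ , row′)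
          (runs-storeValue k<1+q inv′))
      (refl , row , (λ _ ()) , λ _ ()))
    where
    Inv : ℕ → State → Set c
    Inv k = At k (RowValues n k k)

  runs-storeWeight₀ : ∀ {n s} → Filled n s →
                      Runs storeWeight₀ s (worstCost storeWeight₀) (RowWeights n 1 0)
  runs-storeWeight₀ {n} {s} filled@(refl , _) = runs-setReal (RowWeights n 1 0)
    (filled , store-extend W (reals s 3) refl (λ _ ()) , λ _ ())

  runs-storeBest₀ : ∀ {n s} → RowWeights n 1 0 s →
                    Runs storeBest₀ s (worstCost storeBest₀) (RowWeights n 1 1)
  runs-storeBest₀ {n} {s} (filled@(refl , _) , weights , _) = runs-setInt (RowWeights n 1 1)
    (filled , weights , store-extend best (ints s 0) refl λ _ ())

  runs-fillRow : ∀ {n s} → Filled n s →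
                 Runs fillRow s (fillRowCost q) (λ s′ → Filled (suc n) (setVarIn s′ 2 (suc (vars s′ 2))))
  runs-fillRow {n} filled =
    runs-storeWeight₀ filled runs-⨾ λ row → runs-storeBest₀ row runs-⨾ λ row →
    runs-weightLoop row runs-⨾ λ row →
    runs-mono {S = λ s → Filled (suc n) (setVarIn s 2 (suc (vars s 2)))} (λ {s} → nextRow {s}) (runs-valueLoop row)
    where
    nextRow : ∀ {s} → RowValues n (suc q) (suc q) s → Filled (suc n) (setVarIn s 2 (suc (vars s 2)))
    nextRow {s} (((n≡ , base , choices , _) , _) , newChoices , newValues) =
      cong suc n≡ , base , allChoices , newValues
      where
      allChoices : ∀ m k → m < suc n → k < suc q → ints s 1 m k ≡ choice m k
      allChoices m k (s≤s m≤n) k<1+q with m≤n⇒m<n∨m≡n m≤n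
      ... | inj₁ m<n  = choices m k m<n k<1+q
      ... | inj₂ refl = newChoices k k<1+q

  runs-fill : ∀ {s} → Filled 0 (setVarIn s 2 0) →
              Runs fill s (forCost 𝕡 p (fillRowCost q)) (Filled p)
  runs-fill {s} = runs-for Filled proj₁ (λ (_ , (p≡ , _) , _) → p≡) (λ _ → runs-fillRow) {s}

  runs-initialise : ∀ {s} → Base s → Runs initialise s (initialiseCost q) (Initialised (suc q))
  runs-initialise base = runs-for Initialised proj₁ (λ (_ , (_ , q≡ , _) , _) → cong suc q≡)
    (λ { {k} {s} _ (refl , base , values) →
      runs-setReal (λ s → Initialised (suc k) (setVarIn s 3 (suc (vars s 3))))
        (refl , base , store-extend value (reals s 2) refl values) })
    (refl , base , λ _ ())

  codeOf : ℕ → ℕ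
  codeOf i = choice (p ∸ suc i) (openedBefore p 0 i)

  solution : ℕ → ℕ → K
  solution i j = indicator (codeOf i ≡ᵇ suc j)

  Traced : ℕ → State → Set c
  Traced i s = vars s 2 ≡ i × vars s 4 ≡ openedBefore p 0 i × Base s ×
               (∀ m k → m < p → k < suc q → ints s 1 m k ≡ choice m k) ×
               (∀ h j → h < i → j < q → reals s 1 h j ≡ solution h j)

  TracedRow : ℕ → ℕ → State → Set c
  TracedRow i j s = Traced i s × (∀ h → h < j → reals s 1 i h ≡ solution i h)

  code≡ : ∀ {i s} → i < p → Traced i s → intVal s code ≡ codeOf i
  code≡ {i} {s} i<p (refl , k≡ , (p≡ , _) , choices , _) =
    trans (cong₂ (ints s 1) (cong (_∸ suc i) p≡) k≡)
          -- The cell read lies in the filled table: its row is below `p`, and at most `q` columns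
          -- are opened.
          (choices _ _ (ℕ.∸-monoʳ-< {p} (s≤s z≤n) i<p) (s≤s (openedBefore≤q p i z≤n)))

  runs-storeEntry : ∀ {i j s} → i < p → At j (TracedRow i j) s →
                    Runs storeEntry s (worstCost storeEntry) (At j (TracedRow i (suc j)))
  runs-storeEntry {i} {j} {s} i<p (refl , traced@(refl , k≡ , base , choices , written) , new) =
    runs-selectReal (At j (TracedRow i (suc j)))
      (trans (cong (λ c → (c ≤ᵇ suc j) ∧ (suc j ≤ᵇ c)) (code≡ {s = s} i<p traced)) (≤ᵇ-antisym (codeOf i) (suc j)))
      refl refl
      λ v v≡ → refl ,
        (refl , k≡ , base , choices ,
         λ h l h<i l<q → store-agree solution (reals s 1) v≡ (written h l h<i l<q)) ,
        store-extend solution (reals s 1) v≡ new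

  runs-traceRow : ∀ {i s} → i < p → Traced i s →
                  Runs traceRow s (traceRowCost q) (λ s′ → Traced (suc i) (setVarIn s′ 2 (suc (vars s′ 2))))
  runs-traceRow {i} i<p traced =
    runs-for Inv proj₁ (λ (_ , (_ , _ , (_ , q≡ , _) , _) , _) → q≡)
      (λ {j} _ inv → runs-mono {S = λ s → Inv (suc j) (setVarIn s 3 (suc (vars s 3)))}
        (λ (j≡ , row) → cong suc j≡ , row) (runs-storeEntry i<p inv))
      (refl , traced , λ _ ())
    runs-⨾ λ {s′} (_ , row) →
    runs-setVar (λ s → Traced (suc i) (setVarIn s 2 (suc (vars s 2)))) (nextRow {s′} row)
    where
    Inv : ℕ → State → Set c
    Inv j = At j (TracedRow i j)

    nextRow : ∀ {s} → TracedRow i q s →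
              Traced (suc i) (setVarIn (setVarIn s 4 (intVal s (𝕜 ⊕ (code ⊖ 𝕜)))) 2 (suc (vars s 2)))
    nextRow {s} (traced@(i≡ , k≡ , base , choices , written) , new) =
      cong suc i≡ ,
      trans (cong₂ opened k≡ (code≡ {s = s} i<p traced)) (sym (openedBefore-suc p 0 i<p)) ,
      base , choices , allWritten
      where
      allWritten : ∀ h j → h < suc i → j < q → reals s 1 h j ≡ solution h j
      allWritten h j (s≤s h≤i) j<q with m≤n⇒m<n∨m≡n h≤i
      ... | inj₁ h<i  = written h j h<i j<q
      ... | inj₂ refl = new j j<q

  runs-optimise : ∀ {s} → Base s → Runs optimise s (optimiseCost p q)
                  (λ s′ → ∀ i j → i < p → j < q → reals s′ 1 i j ≡ solution i j)
  runs-optimise base =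
    runs-initialise base runs-⨾ λ (_ , base , values) →
    runs-fill (refl , base , (λ _ _ ()) , values) runs-⨾ λ (_ , base , choices , _) →
    -- The postcondition anticipates the reset of variable 2 with which the next loop starts.
    runs-setVar (λ s → Traced 0 (setVarIn s 2 0)) (refl , refl , base , choices , λ _ _ ()) runs-⨾ λ traced →
    runs-mono {S = λ s′ → ∀ i j → i < p → j < q → reals s′ 1 i j ≡ solution i j}
      (λ (_ , _ , _ , _ , written) → written)
      (runs-for Traced proj₁ (λ (_ , _ , (p≡ , _) , _) → p≡) (λ {i} {s} → runs-traceRow {i} {s}) traced)

-- Running time and optimality combined

corollary7 : ∀ {c ℓ₁ ℓ₂} (F : OrderedField c ℓ₁ ℓ₂) →
    let open Orbitope F
        open Machine F
    in
    Σ[ P ∈ Program ] Σ[ C ∈ ℕ ]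
    (∀ (p q : ℕ) → 1 ≤ q → q ≤ p →
    ∀ (d : 𝓘 p q → OrderedField.Carrier F) (s : State) → HoldsInput s p q d →
    ∃[ s′ ] ∃[ t ]
    (P , s ⇓ s′ within t) × t ≤ C * (p * q) × OptimalSolution d (output s′))
corollary7 F = optimise , factor optimiseCost-≼ , solve
  where
  open Algorithm using (optimise; optimiseCost)
  open CostBound using (factor; bound; optimiseCost-≼)
  open Orbitope F
  open TimedExecution F
  open OrderedFieldProperties F using (K; _≈_; ≈-trans; ≈-reflexive; 0#; indicator)

  module _ {p q} (d : 𝓘 p q → K) {s : State} (input : HoldsInput s p q d) where
    open HoldsInput input
    -- The array itself serves as `D`: it matches `d` only up to `≈`, while the invariants are
    -- stated with `≡`.
    open Correctness F p q (reals s 0) using (W; solution)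
    open DynamicProgram F q W using (optimalCodes-openedBefore)

    row≡ : ∀ (i : Fin p) → p ∸ suc (p ∸ suc (toℕ i)) ≡ toℕ i
    row≡ i = trans (cong (p ∸_) (sym (ℕ.+-∸-assoc 1 (toℕ<n i)))) (ℕ.m∸[m∸n]≡n (ℕ.<⇒≤ (toℕ<n i)))

    W-at : ∀ (i : Fin p) {j b} → does (j ≤? toℕ i) ≡ b →
           W (p ∸ suc (toℕ i)) (suc j) ≡ (if b then reals s 0 (toℕ i) j else 0#)
    W-at i {j} refl = cong (λ r → if does (j ≤? r) then reals s 0 r j else 0#) (row≡ i)

    W-entry : ∀ e → W (p ∸ suc (toℕ (row e))) (suc (toℕ (col e))) ≈ d e
    W-entry e@(entry i j j≤i) = ≈-trans
      (≈-reflexive (W-at i (dec-true (toℕ j ≤? toℕ i) (recompute (toℕ j ≤? toℕ i) j≤i))))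
      (holds-d e)

    W-above : ∀ (i : Fin p) (j : Fin q) → ¬ toℕ j ≤ toℕ i →
              W (p ∸ suc (toℕ i)) (suc (toℕ j)) ≈ 0#
    W-above i j j≰i = ≈-reflexive (W-at i (dec-false (_ ≤? _) j≰i))

    solution-optimal : ∀ {s′} → (∀ i j → i < p → j < q → reals s′ 1 i j ≡ solution i j) →
                       OptimalSolution d (output s′)
    solution-optimal written =
      Optimality.optimalCodes-optimal F W d (λ _ → refl) W-entry W-above λ e →
        trans (written _ _ (toℕ<n (row e)) (toℕ<n (col e)))
              (cong (λ c → indicator (c ≡ᵇ suc (toℕ (col e))))
                    (sym (optimalCodes-openedBefore p 0 (row e))))

  solve : ∀ p q → 1 ≤ q → q ≤ p → ∀ (d : 𝓘 p q → K) s → HoldsInput s p q d →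
          ∃[ s′ ] ∃[ t ] (optimise , s ⇓ s′ within t) ×
                         t ≤ factor optimiseCost-≼ * (p * q) × OptimalSolution d (output s′)
  -- By 1 ≤ q ≤ p both dimensions are successors, as the cost bound requires.
  solve (suc p) (suc q) _ _ d s input = extract
    (Correctness.runs-optimise F (suc p) (suc q) (reals s 0) {s}
      (HoldsInput.holds-p input , HoldsInput.holds-q input , λ _ _ → refl))
    where
    extract : Runs optimise s (optimiseCost (suc p) (suc q))
                (λ s′ → ∀ i j → i < suc p → j < suc q →
                        reals s′ 1 i j ≡ Correctness.solution F (suc p) (suc q) (reals s 0) i j) → _
    extract (s′ , t , P⇓ , t≤ , written) =
      s′ , t , P⇓ ,
      ≤-trans t≤ (≤-trans (bound optimiseCost-≼ (p , q))
                          (ℕ.≤-reflexive (ℕ.*-comm (suc p * suc q) (factor optimiseCost-≼)))) ,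
      solution-optimal d input {s′} written
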